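{- For every positive integer $n$, the perfect edge-magic deficiency of the star $K_{1,n}$ is finite: $\mu_p(K_{1,n})<+\infty$.
   Context: Graphs are finite and simple. The notation $[a,b]$ denotes the set of integers $x$ with $a\le x\le b$, and $G\cup mK_1$ is the disjoint union of $G$ with $m$ isolated vertices. An edge-magic labeling of a graph $G$ is a bijection $f:V(G)\cup E(G)\to[1,|V(G)|+|E(G)|]$ such that $f(u)+f(v)+f(uv)$ equals a constant (the valence of $f$) for every $uv\in E(G)$. For a graph $G$ with at least one edge, let $$T_G=\left\{\frac{\sum_{u\in V(G)}\deg(u)g(u)+\sum_{e\in E(G)}g(e)}{|E(G)|} : g:V(G)\cup E(G)\to[1,|V(G)|+|E(G)|]\text{ bijective}\right\}.$$ If $\lceil\min T_G\rceil\le\lfloor\max T_G\rfloor$, the edge-magic interval of $G$ is $\lambda_G=[\lceil\min T_G\rceil,\lfloor\max T_G\rfloor]$. The edge-magic set of $G$ is $$\tau_G=\{k\in\lambda_G : \text{there exists an edge-magic labeling of }G\text{ with valence }k\}.$$ $G$ is perfect edge-magic if $\lambda_G=\tau_G$. The perfect edge-magic deficiency $\mu_p(G)$ of a graph $G$ is the smallest nonnegative integer $m$ such that $G\cup mK_1$ is perfect edge-magic, or $+\infty$ if no such $m$ exists. -}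

module Defs where

open import Data.Bool.Base using (if_then_else_)
open import Data.Fin.Base as Fin using (Fin; zero; suc; toℕ; _↑ˡ_)
open import Data.Fin.Properties as Fin using (toℕ-↑ˡ; ↑ˡ-injective)
open import Data.Integer.Base as ℤ using (ℤ; +_)
open import Data.Nat.Base as ℕ using (ℕ; _+_; _*_; NonZero; s≤s; z≤n)
open import Data.Nat.Properties as ℕ using (+-0-commutativeMonoid)
open import Algebra.Properties.CommutativeMonoid.Sum +-0-commutativeMonoid using (sum-syntax)
open import Data.Product.Base using (Σ-syntax; _×_; _,_)
open import Data.Rational.Base as ℚ using (ℚ; _/_; floor; ceiling)
open import Data.Sum.Base using (_⊎_; inj₁; inj₂)
open import Function.Base using (flip)
open import Function.Bundles using (_⤖_; module Bijection)
open import Level using (0ℓ)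
open import Relation.Binary.Core using (Rel)
open import Relation.Binary.PropositionalEquality
  using (_≡_; refl; sym; cong; subst₂)
open import Relation.Nullary.Construct.Add.Supremum using (_⁺; [_]; ⊤⁺)
open import Relation.Nullary.Decidable using (Dec; does; _⊎-dec_)
open import Relation.Nullary.Negation using (¬_; contradiction)
open import Relation.Unary using (Pred; _∈_; _≐_)

-- The unordered edge {u , v} is stored once, smaller endpoint first; `ordered`
-- excludes loops and `simple` excludes repeated edges.
record Graph : Set where
  field
    order   : ℕ
    size    : ℕ
    src tgt : Fin size → Fin order
    ordered : ∀ e → src e Fin.< tgt e
    simple  : ∀ {e e′} → src e ≡ src e′ → tgt e ≡ tgt e′ → e ≡ e′

open Graph public

V E : Graph → Set
V G = Fin (order G)
E G = Fin (size G)

star : ℕ → Graph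
star n = record
  { order   = ℕ.suc n
  ; size    = n
  ; src     = λ _ → zero
  ; tgt     = suc
  ; ordered = λ _ → s≤s z≤n
  ; simple  = λ _ → Fin.suc-injective
  }

infixl 6 _∪_K₁

_∪_K₁ : Graph → ℕ → Graph
G ∪ m K₁ = record
  { order   = order G + m
  ; size    = size G
  ; src     = λ e → src G e ↑ˡ m
  ; tgt     = λ e → tgt G e ↑ˡ m
  ; ordered = λ e → subst₂ ℕ._<_ (sym (toℕ-↑ˡ (src G e) m))
                                 (sym (toℕ-↑ˡ (tgt G e) m)) (ordered G e)
  ; simple  = λ p q → simple G (↑ˡ-injective m _ _ p) (↑ˡ-injective m _ _ q)
  }

Incident : ∀ G → V G → E G → Set
Incident G u e = u ≡ src G e ⊎ u ≡ tgt G e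

incident? : ∀ G u e → Dec (Incident G u e)
incident? G u e = (u Fin.≟ src G e) ⊎-dec (u Fin.≟ tgt G e)

deg : ∀ G → V G → ℕ
deg G u = ∑[ e < size G ] (if does (incident? G u e) then 1 else 0)

-- A bijection V ∪ E → [1, |V| + |E|]; the element i of Fin N stands for the
-- label 1 + i.
Labeling : Graph → Set
Labeling G = (V G ⊎ E G) ⤖ Fin (order G + size G)

module _ (G : Graph) (g : Labeling G) where

  label : V G ⊎ E G → ℕ
  label x = ℕ.suc (toℕ (Bijection.to g x))

  vlabel : V G → ℕ
  vlabel u = label (inj₁ u)

  elabel : E G → ℕ
  elabel e = label (inj₂ e)

  weightedSum : ℕ
  weightedSum = (∑[ u < order G ] (deg G u * vlabel u)) + (∑[ e < size G ] elabel e)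

  IsEdgeMagic : ℤ → Set
  IsEdgeMagic k =
    ∀ e → + (vlabel (src G e) + vlabel (tgt G e) + elabel e) ≡ k

IsLeast : {A : Set} → Rel A 0ℓ → Pred A 0ℓ → Pred A 0ℓ
IsLeast _≤_ P x = x ∈ P × (∀ {y} → y ∈ P → x ≤ y)

IsGreatest : {A : Set} → Rel A 0ℓ → Pred A 0ℓ → Pred A 0ℓ
IsGreatest _≤_ = IsLeast (flip _≤_)

module _ (G : Graph) .{{_ : NonZero (size G)}} where

  T : Pred ℚ 0ℓ
  T x = Σ[ g ∈ Labeling G ] x ≡ + weightedSum G g / size G

  -- Inhabited exactly when ⌈min T⌉ ≤ ⌊max T⌋, i.e. when the edge-magic
  -- interval is defined.
  record HasInterval : Set where
    field
      minT maxT : ℚ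
      isMin     : IsLeast ℚ._≤_ T minT
      isMax     : IsGreatest ℚ._≤_ T maxT
      nonempty  : ceiling minT ℤ.≤ floor maxT

  module _ (I : HasInterval) where
    open HasInterval I

    edgeMagicInterval : Pred ℤ 0ℓ
    edgeMagicInterval k = ceiling minT ℤ.≤ k × k ℤ.≤ floor maxT

    edgeMagicSet : Pred ℤ 0ℓ
    edgeMagicSet k = k ∈ edgeMagicInterval × (Σ[ f ∈ Labeling G ] IsEdgeMagic G f k)

  PerfectEdgeMagic : Set
  PerfectEdgeMagic = Σ[ I ∈ HasInterval ] edgeMagicInterval I ≐ edgeMagicSet I

-- μₚ(G), an element of ℕ ∪ {+∞} = ℕ ⁺ (with ⊤⁺ as +∞), given by its graph
-- because deciding between a finite value and +∞ is not computable in general.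
IsDeficiency : ∀ G → .{{_ : NonZero (size G)}} → Pred (ℕ ⁺) 0ℓ
IsDeficiency G [ m ] = IsLeast ℕ._≤_ (λ i → PerfectEdgeMagic (G ∪ i K₁)) m
IsDeficiency G ⊤⁺    = ∀ i → ¬ PerfectEdgeMagic (G ∪ i K₁)

IsDeficiency-unique : ∀ G .{{_ : NonZero (size G)}} {μ ν} →
                      IsDeficiency G μ → IsDeficiency G ν → μ ≡ ν
IsDeficiency-unique G {[ _ ]} {[ _ ]} (p , l) (q , l′) = cong [_] (ℕ.≤-antisym (l q) (l′ p))
IsDeficiency-unique G {[ m ]} {⊤⁺}    (p , _) never    = contradiction p (never m)
IsDeficiency-unique G {⊤⁺}    {[ m ]} never (p , _)    = contradiction p (never m)
IsDeficiency-unique G {⊤⁺}    {⊤⁺}    _ _              = refl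

{-# OPTIONS --safe #-}

-- Put N = 2n + 1 + m, the number of labels of K_{1,n} ∪ mK₁. Summing over the edges,
-- the weighted sum of a labeling is n c + S with c the label of the centre and S
-- the sum of the 2n labels of leaves and edges; it equals n k if the labeling is
-- edge-magic of valence k. As c + S is a sum of 2n + 1 distinct positive integers,
-- min T ≥ 2n + 4, and this value is a valence. Complementing labels, x ↦ N + 1 - x,
-- exchanges valences k and 3(N + 1) - k, so the interval is [2n + 4 , 4n + 2 + 3m]
-- for every m.
--
-- Giving the centre the label 1 and pairing two disjoint blocks of n consecutive
-- labels in opposite orders realises, when m = 2n, every valence in the lower half
-- of the interval; complementation gives the upper half. Hence K_{1,n} ∪ 2nK₁ is
-- perfect edge-magic. Being perfect edge-magic is decidable by finite search, so
-- there is a least such m.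
module Submission where

open import Defs
open import Data.Nat.Base using (ℕ; NonZero; _<_)
open import Data.Product.Base using (∃-syntax; _×_)
open import Relation.Nullary.Construct.Add.Supremum using (_⁺; ⊤⁺)
open import Relation.Binary.Construct.Add.Supremum.Strict _<_ using (_<⁺_)

open import Data.Bool.Base using (if_then_else_)
open import Data.Fin.Base as Fin
  using (Fin; zero; suc; toℕ; fromℕ<; _↑ˡ_; _↑ʳ_; splitAt; join; opposite; punchOut; punchIn)
open import Data.Fin.Properties as Fin using (all?; any?)
open import Data.Integer.Base as ℤ using (+_)
import Data.Integer.Properties as ℤ
open import Data.Nat.Base using (zero; suc; _+_; _*_; _∸_; _≤_; z≤n; s≤s; z<s)
import Data.Nat.Coprimality as Coprimality
import Data.Nat.DivMod as ℕ
import Data.Nat.Properties as ℕ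
open import Data.Nat.Tactic.RingSolver using (solve-∀)
open import Algebra.Properties.CommutativeMonoid.Sum ℕ.+-0-commutativeMonoid
open import Algebra.Properties.Semiring.Sum ℕ.+-*-semiring using (*-distribʳ-sum)
open import Algebra.Properties.CommutativeSemigroup ℕ.+-commutativeSemigroup using (xy∙z≈xz∙y)
open import Data.Product.Base using (∃; Σ-syntax; _,_; proj₁; proj₂)
open import Data.Rational.Base as ℚ using (ℚ; mkℚ; _/_; floor; ceiling; toℚᵘ)
import Data.Rational.Properties as ℚ
open import Data.Rational.Unnormalised.Base as ℚᵘ using (mkℚᵘ)
import Data.Rational.Unnormalised.Properties as ℚᵘ
open import Data.Sum.Base using (_⊎_; inj₁; inj₂; [_,_]′)
open import Data.Sum.Properties using (inj₁-injective; inj₂-injective)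
open import Data.Vec.Functional using (_∷_; head; tail)
open import Function.Base using (_∘_)
open import Function.Bundles using (mk⤖; module Bijection)
open import Function.Consequences.Propositional using (inverseʳ⇒injective; strictlyInverseʳ⇒inverseʳ)
open import Function.Definitions using (Injective; Surjective)
open import Relation.Binary.PropositionalEquality as ≡
  using (_≡_; _≢_; _≗_; refl; sym; trans; cong; cong₂; subst; subst₂)
open import Relation.Nullary.Construct.Add.Supremum using ([_])
open import Relation.Binary.Construct.Add.Supremum.Strict _<_ using ([_]<⊤⁺)
open import Relation.Nullary.Decidable using (Dec; yes; no; does; map′; _×-dec_; _→-dec_; ¬?)
open import Relation.Nullary.Negation using (contradiction)

Inj : {A B : Set} → (A → B) → Set
Inj = Injective _≡_ _≡_

-- Finite search

least : ∀ {P : ℕ → Set} → (∀ i → Dec (P i)) → ∀ m → P m → ∃ (IsLeast _≤_ P)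
least P? m p with P? 0
least P? m       p | yes p₀ = 0 , p₀ , λ _ → z≤n
least P? zero    p | no ¬p₀ = contradiction p ¬p₀
least P? (suc m) p | no ¬p₀ with least (P? ∘ suc) m p
... | i , pᵢ , min = suc i , pᵢ ,
  λ { {zero}  p₀ → contradiction p₀ ¬p₀
    ; {suc j} pⱼ → s≤s (min pⱼ) }

-- `P` has to respect pointwise equality because the function rebuilt from `head` and `tail` agrees
-- with `f` only pointwise.
∃-function? : ∀ r {N} {P : (Fin r → Fin N) → Set} →
              (∀ {f g} → f ≗ g → P f → P g) → (∀ f → Dec (P f)) → Dec (∃ P)
∃-function? zero resp P? = map′ (_ ,_) (λ (f , p) → resp (λ ()) p) (P? λ ())
∃-function? (suc r) resp P? = map′
  (λ (x , f , p) → x ∷ f , p)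
  (λ (f , p) → head f , tail f , resp (λ { zero → refl ; (suc i) → refl }) p)
  (any? λ x → ∃-function? r
    (λ f≗g → resp λ { zero → refl ; (suc i) → f≗g i })
    (λ f → P? (x ∷ f)))

injective? : ∀ {r N} (f : Fin r → Fin N) → Dec (Inj f)
injective? f = map′ (λ inj {i} {j} → inj i j) (λ inj i j → inj)
  (all? λ i → all? λ j → (f i Fin.≟ f j) →-dec (i Fin.≟ j))

-- Injections into finite sets

retraction⇒injective : ∀ {A B : Set} {f : A → B} (g : B → A) → (∀ x → g (f x) ≡ x) → Inj f
retraction⇒injective {f = f} g gf≗id = inverseʳ⇒injective {f⁻¹ = g} f (strictlyInverseʳ⇒inverseʳ f gf≗id)

splitAt-injective : ∀ m {n} → Inj (splitAt m {n})
splitAt-injective m {n} = retraction⇒injective (join m n) (Fin.join-splitAt m n)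

join-injective : ∀ m n → Inj (join m n)
join-injective m n = retraction⇒injective (splitAt m) (Fin.splitAt-join m n)

opposite-injective : ∀ {n} → Inj (opposite {n})
opposite-injective = retraction⇒injective opposite Fin.opposite-involutive

-- Were every value hit, choosing preimages would inject `Fin N` into the smaller `Fin r`.
∃-missed : ∀ {r N} → r < N → (f : Fin r → Fin N) → ∃[ y ] (∀ i → f i ≢ y)
∃-missed {r} {N} r<N f with any? (λ y → all? λ i → ¬? (f i Fin.≟ y))
... | yes missed = missed
... | no ¬missed = contradiction (Fin.injective⇒≤ section-injective) (ℕ.<⇒≱ r<N)
  where
  preimage : ∀ y → ∃[ i ] (f i ≡ y)
  preimage y with any? (λ i → f i Fin.≟ y)
  ... | yes hit = hit
  ... | no ¬hit = contradiction (y , λ i fi≡y → ¬hit (i , fi≡y)) ¬missed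
  section-injective : Inj (proj₁ ∘ preimage)
  section-injective {x} {y} eq =
    trans (sym (proj₂ (preimage x))) (trans (cong f eq) (proj₂ (preimage y)))

-- Deleting a missed value with `punchOut` would inject `Fin (suc N)` into `Fin N`.
injective⇒surjective : ∀ {N} {f : Fin N → Fin N} → Inj f → ∀ y → ∃[ i ] (f i ≡ y)
injective⇒surjective {zero}  inj ()
injective⇒surjective {suc N} {f} inj y with any? (λ i → f i Fin.≟ y)
... | yes hit = hit
... | no ¬hit = contradiction (Fin.injective⇒≤ punched-injective) ℕ.1+n≰n
  where
  y≢f : ∀ i → y ≢ f i
  y≢f i y≡fi = ¬hit (i , sym y≡fi)
  punched-injective : Inj (λ i → punchOut (y≢f i))
  punched-injective {i} {j} eq = inj (Fin.punchOut-injective (y≢f i) (y≢f j) eq)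

-- Supplies leftover labels for the isolated vertices. Each round puts one missed value in front of
-- `f`, so the induction only has to carry injectivity and the count.
∃-extension : ∀ m {r N} (f : Fin r → Fin N) → Inj f → r + m ≤ N →
              Σ[ t ∈ (Fin m → Fin N) ] Inj [ f , t ]′
∃-extension zero f inj _ = (λ ()) ,
  λ { {inj₁ i} {inj₁ j} eq → cong inj₁ (inj eq) }
∃-extension (suc m) {r} f inj r+m≤N
  with y , f≢y ← ∃-missed (ℕ.≤-trans (ℕ.m<m+n r z<s) r+m≤N) f
  with t , inj′ ← ∃-extension m (y ∷ f)
         (λ { {zero}  {zero}  _  → refl
            ; {zero}  {suc j} eq → contradiction (sym eq) (f≢y j)
            ; {suc i} {zero}  eq → contradiction eq (f≢y i)
            ; {suc i} {suc j} eq → cong suc (inj eq) })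
         (ℕ.≤-trans (ℕ.≤-reflexive (sym (ℕ.+-suc r m))) r+m≤N)
  = y ∷ t , λ {x} {z} eq → shift-injective x z (inj′ (trans (sym (shift-≡ x)) (trans eq (shift-≡ z))))
  where
  shift : Fin r ⊎ Fin (suc m) → Fin (suc r) ⊎ Fin m
  shift (inj₁ i)       = inj₁ (suc i)
  shift (inj₂ zero)    = inj₁ zero
  shift (inj₂ (suc j)) = inj₂ j
  shift-injective : ∀ x z → shift x ≡ shift z → x ≡ z
  shift-injective (inj₁ i)       (inj₁ j)       refl = refl
  shift-injective (inj₂ zero)    (inj₂ zero)    refl = refl
  shift-injective (inj₂ (suc i)) (inj₂ (suc j)) refl = refl
  shift-injective (inj₁ _)       (inj₂ zero)    ()
  shift-injective (inj₁ _)       (inj₂ (suc _)) ()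
  shift-≡ : ∀ x → [ f , y ∷ t ]′ x ≡ [ y ∷ f , t ]′ (shift x)
  shift-≡ (inj₁ i)       = refl
  shift-≡ (inj₂ zero)    = refl
  shift-≡ (inj₂ (suc j)) = refl

-- In a labeling of `G ∪ m K₁` the isolated vertices sit beside the other vertices, whereas
-- `∃-extension` splits them off as a second summand. This permutation of blocks translates; its
-- inverse swaps `b` and `c`.
exchange : ∀ a b c → Fin (a + b) ⊎ Fin c → Fin (a + c) ⊎ Fin b
exchange a b c (inj₁ i) = [ inj₁ ∘ (_↑ˡ c) , inj₂ ]′ (splitAt a i)
exchange a b c (inj₂ j) = inj₁ (a ↑ʳ j)

exchange-involutive : ∀ a b c x → exchange a c b (exchange a b c x) ≡ x
exchange-involutive a b c (inj₂ j) = cong [ _ , inj₂ ]′ (Fin.splitAt-↑ʳ a c j)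
exchange-involutive a b c (inj₁ i) with splitAt a i in eq
... | inj₁ u = trans (cong [ _ , inj₂ ]′ (Fin.splitAt-↑ˡ a u c)) (cong inj₁ (Fin.splitAt⁻¹-↑ˡ eq))
... | inj₂ v = cong inj₁ (Fin.splitAt⁻¹-↑ʳ eq)

-- Sums of distinct positive integers

∃-large : ∀ {r} {f : Fin (suc r) → ℕ} → Inj f → ∃[ i ] (r ≤ f i)
∃-large {r} {f} inj with any? (λ i → r ℕ.≤? f i)
... | yes large = large
... | no ¬large = contradiction (Fin.injective⇒≤ bounded-injective) ℕ.1+n≰n
  where
  f<r : ∀ i → f i < r
  f<r i = ℕ.≰⇒> λ r≤fi → ¬large (i , r≤fi)
  bounded-injective : Inj (λ i → fromℕ< (f<r i))
  bounded-injective {i} {j} eq = inj (Fin.fromℕ<-injective _ _ (f<r i) (f<r j) eq)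

-- Doubling avoids halving the triangular number. Among `suc r` distinct values some `f i` is at
-- least `r`; removing `i` leaves `r` distinct values for the induction.
sum-injective-≥ : ∀ r {f : Fin r → ℕ} → Inj f → r * suc r ≤ 2 * sum (suc ∘ f)
sum-injective-≥ zero    inj = z≤n
sum-injective-≥ (suc r) {f} inj with i , r≤fi ← ∃-large inj = begin
  suc r * suc (suc r)              ≡⟨ split r ⟩
  2 * suc r + r * suc r            ≤⟨ ℕ.+-mono-≤ (ℕ.*-monoʳ-≤ 2 (s≤s r≤fi))
                                        (sum-injective-≥ r (Fin.punchIn-injective i _ _ ∘ inj)) ⟩
  2 * suc (f i) + 2 * sum (suc ∘ f ∘ punchIn i)
                                   ≡⟨ ℕ.*-distribˡ-+ 2 (suc (f i)) _ ⟨
  2 * (suc (f i) + sum (suc ∘ f ∘ punchIn i))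
                                   ≡⟨ cong (2 *_) (sum-remove {i = i} (suc ∘ f)) ⟨
  2 * sum (suc ∘ f)                ∎
  where
  open ℕ.≤-Reasoning
  split : ∀ r → suc r * suc (suc r) ≡ 2 * suc r + r * suc r
  split = solve-∀

-- Rational endpoints

module _ (n : ℕ) .{{_ : NonZero n}} where

  /-mono-≤ : ∀ {a b} → a ≤ b → + a / n ℚ.≤ + b / n
  /-mono-≤ = go n
    where
    go : ∀ n .{{_ : NonZero n}} {a b} → a ≤ b → + a / n ℚ.≤ + b / n
    go (suc p) {a} {b} a≤b = ℚ.toℚᵘ-cancel-≤ (begin
      toℚᵘ (+ a / suc p)  ≃⟨ ℚ.toℚᵘ-fromℚᵘ (mkℚᵘ (+ a) p) ⟩
      mkℚᵘ (+ a) p        ≤⟨ ℚᵘ.*≤* (ℤ.*-monoʳ-≤-nonNeg (+ suc p) (ℤ.+≤+ a≤b)) ⟩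
      mkℚᵘ (+ b) p        ≃⟨ ℚ.toℚᵘ-fromℚᵘ (mkℚᵘ (+ b) p) ⟨
      toℚᵘ (+ b / suc p)  ∎)
      where open ℚᵘ.≤-Reasoning

  -- The explicit normal form with denominator 1 lets `floor` and `ceiling` compute.
  n*k/n : ∀ k → + (n * k) / n ≡ mkℚ (+ k) 0 (Coprimality.sym (Coprimality.1-coprimeTo k))
  n*k/n k = go n
    where
    go : ∀ n .{{_ : NonZero n}} → + (n * k) / n ≡ mkℚ (+ k) 0 (Coprimality.sym (Coprimality.1-coprimeTo k))
    go (suc p) = trans
      (ℚ.fromℚᵘ-cong {mkℚᵘ (+ (suc p * k)) p} {mkℚᵘ (+ k) 0} (ℚᵘ.*≡* (begin
        + (suc p * k) ℤ.* + 1  ≡⟨ ℤ.*-identityʳ _ ⟩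
        + (suc p * k)          ≡⟨ cong +_ (ℕ.*-comm (suc p) k) ⟩
        + (k * suc p)          ≡⟨ ℤ.pos-* k (suc p) ⟩
        + k ℤ.* + suc p        ∎)))
      (ℚ.normalize-coprime (Coprimality.sym (Coprimality.1-coprimeTo k)))
      where open ≡.≡-Reasoning

  floor-n*k/n : ∀ k → floor (+ (n * k) / n) ≡ + k
  floor-n*k/n k rewrite n*k/n k = trans (ℤ.*-identityˡ _) (cong +_ (ℕ.n/1≡n k))

  ceiling-n*k/n : ∀ k → ceiling (+ (n * k) / n) ≡ + k
  ceiling-n*k/n k rewrite n*k/n k = go k
    where
    go : ∀ k → ceiling (mkℚ (+ k) 0 (Coprimality.sym (Coprimality.1-coprimeTo k))) ≡ + k
    go zero    = refl
    -- The ceiling is minus the floor of the negated number, and division of a negative integer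
    -- branches on the remainder, here modulo 1.
    go (suc k) rewrite ℕ.n%1≡0 (suc k) | ℕ.n/1≡n (suc k) = cong (λ j → + suc j) (ℕ.+-identityʳ k)

-- Labelings of an arbitrary graph

module _ (G : Graph) where

  labelCount : ℕ
  labelCount = order G + size G

  -- Domain and codomain both have `labelCount` elements, so injectivity gives surjectivity.
  labeling : (f : V G ⊎ E G → Fin labelCount) → Inj f → Labeling G
  labeling f inj = mk⤖ (inj , surjective)
    where
    surjective : Surjective _≡_ _≡_ f
    surjective y with i , fi≡y ← injective⇒surjective (splitAt-injective (order G) ∘ inj) y =
      splitAt (order G) i , λ { refl → fi≡y }

  edgeSum : (V G ⊎ E G → ℕ) → E G → ℕ
  edgeSum x e = x (inj₁ (src G e)) + x (inj₁ (tgt G e)) + x (inj₂ e)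

  edgeSum-cong : ∀ {x y} → x ≗ y → edgeSum x ≗ edgeSum y
  edgeSum-cong x≗y e = cong₂ _+_ (cong₂ _+_ (x≗y _) (x≗y _)) (x≗y _)

  IsValence : ℕ → Set
  IsValence k = Σ[ f ∈ Labeling G ] IsEdgeMagic G f (+ k)

  -- Through `join` and `splitAt`, labelings become injections of `Fin labelCount` into itself, a
  -- finite search space.
  isValence? : ∀ k → Dec (IsValence k)
  isValence? k = map′
    (λ (h , inj , magic) →
      labeling (h ∘ join (order G) (size G)) (λ {x} {y} eq → join-injective _ _ {x} {y} (inj eq)) ,
      λ e → cong +_ (magic e))
    (λ (f , magic) → Bijection.to f ∘ splitAt (order G) ,
      (λ {i} {j} eq → splitAt-injective (order G) {x = i} {j} (Bijection.injective f eq)) ,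
      λ e → trans (edgeSum-cong (λ x → cong (suc ∘ toℕ ∘ Bijection.to f) (Fin.splitAt-join _ _ x)) e)
                  (ℤ.+-injective (magic e)))
    (∃-function? labelCount
      (λ f≗g (inj , magic) →
        (λ {i} {j} eq → inj (trans (f≗g i) (trans eq (sym (f≗g j))))) ,
        λ e → trans (sym (edgeSum-cong (λ x → cong (suc ∘ toℕ) (f≗g (join _ _ x))) e)) (magic e))
      (λ h → injective? h ×-dec all? λ e → edgeSum (suc ∘ toℕ ∘ h ∘ join _ _) e ℕ.≟ k))

-- Weighted sums and complementary labelings

sum-splitAt : ∀ a {b} (x : Fin (a + b) → ℕ) → sum x ≡ sum (x ∘ (_↑ˡ b)) + sum (x ∘ (a ↑ʳ_))
sum-splitAt zero    x = refl
sum-splitAt (suc a) x = trans (cong (_+_ (x zero)) (sum-splitAt a (x ∘ suc)))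
                              (sym (ℕ.+-assoc (x zero) _ _))

sum-const : ∀ n k → ∑[ _ < n ] k ≡ n * k
sum-const zero    k = refl
sum-const (suc n) k = cong (_+_ k) (sum-const n k)

δ : ∀ {n} → Fin n → Fin n → ℕ
δ u s = if does (u Fin.≟ s) then 1 else 0

sum-δ : ∀ {n} (s : Fin n) (x : Fin n → ℕ) → ∑[ u < n ] (δ u s * x u) ≡ x s
sum-δ {suc n} zero    x = trans (cong₂ _+_ (ℕ.*-identityˡ (x zero)) (sum-replicate-zero n))
                                (ℕ.+-identityʳ _)
sum-δ         (suc s) x = sum-δ s (x ∘ suc)

-- Double counting of incidences: after the two sums are swapped, each edge contributes exactly its
-- two endpoints.
handshake : ∀ G (x : V G → ℕ) →
            ∑[ u < order G ] (deg G u * x u) ≡ ∑[ e < size G ] (x (src G e) + x (tgt G e))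
handshake G x = begin
  ∑[ u < order G ] (deg G u * x u)
    ≡⟨ sum-cong-≗ (λ u → *-distribʳ-sum (x u) (incidence u)) ⟩
  ∑[ u < order G ] ∑[ e < size G ] (incidence u e * x u)
    ≡⟨ ∑-comm (λ u e → incidence u e * x u) ⟩
  ∑[ e < size G ] ∑[ u < order G ] (incidence u e * x u)
    ≡⟨ sum-cong-≗ (λ e → trans (sum-cong-≗ (split e)) (∑-distrib-+ (λ u → δ u (src G e) * x u) _)) ⟩
  ∑[ e < size G ] (∑[ u < order G ] (δ u (src G e) * x u) + ∑[ u < order G ] (δ u (tgt G e) * x u))
    ≡⟨ sum-cong-≗ (λ e → cong₂ _+_ (sum-δ (src G e) x) (sum-δ (tgt G e) x)) ⟩
  ∑[ e < size G ] (x (src G e) + x (tgt G e)) ∎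
  where
  open ≡.≡-Reasoning
  incidence : V G → E G → ℕ
  incidence u e = if does (incident? G u e) then 1 else 0
  split : ∀ e u → incidence u e * x u ≡ δ u (src G e) * x u + δ u (tgt G e) * x u
  split e u with u Fin.≟ src G e | u Fin.≟ tgt G e
  -- A loop would count once on the left and twice on the right; `ordered` rules it out.
  ... | yes refl | yes eq = contradiction (ordered G e) (Fin.<-irrefl eq)
  ... | yes _    | no _   = sym (ℕ.+-identityʳ _)
  ... | no _     | yes _  = refl
  ... | no _     | no _   = refl

module _ (G : Graph) where

  weightedSum-edges : ∀ g → weightedSum G g ≡ sum (edgeSum G (label G g))
  weightedSum-edges g =
    trans (cong (_+ sum (elabel G g)) (handshake G (vlabel G g)))
          (sym (∑-distrib-+ (λ e → vlabel G g (src G e) + vlabel G g (tgt G e)) (elabel G g)))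

  weightedSum-magic : ∀ g k → IsEdgeMagic G g (+ k) → weightedSum G g ≡ size G * k
  weightedSum-magic g k magic =
    trans (weightedSum-edges g) (trans (sum-cong-≗ (ℤ.+-injective ∘ magic)) (sum-const (size G) k))

  complement : Labeling G → Labeling G
  complement g = labeling G (opposite ∘ Bijection.to g) (Bijection.injective g ∘ opposite-injective)

  label-complement : ∀ g x → label G g x + label G (complement g) x ≡ suc (labelCount G)
  label-complement g x = begin
    suc (toℕ i) + suc (toℕ (opposite i))              ≡⟨ cong (λ j → suc (toℕ i) + suc j) (Fin.opposite-prop i) ⟩
    suc (toℕ i) + suc (labelCount G ∸ suc (toℕ i))    ≡⟨ ℕ.+-suc (suc (toℕ i)) _ ⟩
    suc (suc (toℕ i) + (labelCount G ∸ suc (toℕ i)))  ≡⟨ cong suc (ℕ.m+[n∸m]≡n (Fin.toℕ<n i)) ⟩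
    suc (labelCount G)                                ∎
    where
    open ≡.≡-Reasoning
    i = Bijection.to g x

  edgeSum-complement : ∀ g e → edgeSum G (label G g) e + edgeSum G (label G (complement g)) e
                             ≡ 3 * suc (labelCount G)
  edgeSum-complement g e = trans
    (regroup (vlabel G g (src G e)) _ _ (vlabel G (complement g) (src G e)) _ _)
    (cong₂ _+_ (label-complement g _)
      -- `3 * x` unfolds to `x + (x + (x + 0))`, whence the final zero.
      (cong₂ _+_ (label-complement g _) (trans (label-complement g _) (sym (ℕ.+-identityʳ _)))))
    where
    regroup : ∀ a b c a′ b′ c′ → (a + b + c) + (a′ + b′ + c′) ≡ (a + a′) + ((b + b′) + (c + c′))
    regroup = solve-∀

  weightedSum-complement : ∀ g →
    weightedSum G g + weightedSum G (complement g) ≡ size G * (3 * suc (labelCount G))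
  weightedSum-complement g = begin
    weightedSum G g + weightedSum G (complement g)
      ≡⟨ cong₂ _+_ (weightedSum-edges g) (weightedSum-edges (complement g)) ⟩
    sum (edgeSum G (label G g)) + sum (edgeSum G (label G (complement g)))
      ≡⟨ ∑-distrib-+ (edgeSum G (label G g)) _ ⟨
    ∑[ e < size G ] (edgeSum G (label G g) e + edgeSum G (label G (complement g)) e)
      ≡⟨ sum-cong-≗ (edgeSum-complement g) ⟩
    ∑[ _ < size G ] (3 * suc (labelCount G))
      ≡⟨ sum-const (size G) _ ⟩
    size G * (3 * suc (labelCount G)) ∎
    where open ≡.≡-Reasoning

  isValence-complement : ∀ {k k′} → k + k′ ≡ 3 * suc (labelCount G) → IsValence G k → IsValence G k′
  isValence-complement {k} k+k′ (g , magic) = complement g , λ e → cong +_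
    (ℕ.+-cancelˡ-≡ k _ _ (trans
      (cong (_+ _) (sym (ℤ.+-injective (magic e))))
      (trans (edgeSum-complement g e) (sym k+k′))))

-- Graphs for which the extreme values of T are valences

record Extremes (G : Graph) (lo hi : ℕ) : Set where
  field
    lo≤hi      : lo ≤ hi
    lo-valence : IsValence G lo
    hi-valence : IsValence G hi
    lo-bound   : ∀ g → size G * lo ≤ weightedSum G g
    hi-bound   : ∀ g → weightedSum G g ≤ size G * hi

module _ {G : Graph} .{{_ : NonZero (size G)}} {lo hi : ℕ} (X : Extremes G lo hi) where
  open Extremes X

  private
    ratio : ℕ → ℚ
    ratio k = + (size G * k) / size G

  -- A labeling of valence `k` has weighted sum `size G * k`. As `lo` and `hi` are valences, the
  -- bounds on `T` are attained, and they are already integers.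
  valence∈T : ∀ {k} → IsValence G k → T G (ratio k)
  valence∈T {k} (g , magic) = g , cong (λ w → + w / size G) (sym (weightedSum-magic G g k magic))

  isLeast-lo : IsLeast ℚ._≤_ (T G) (ratio lo)
  isLeast-lo = valence∈T lo-valence , λ { (g , refl) → /-mono-≤ (size G) (lo-bound g) }

  isGreatest-hi : IsGreatest ℚ._≤_ (T G) (ratio hi)
  isGreatest-hi = valence∈T hi-valence , λ { (g , refl) → /-mono-≤ (size G) (hi-bound g) }

  hasInterval : HasInterval G
  hasInterval = record
    { minT     = ratio lo
    ; maxT     = ratio hi
    ; isMin    = isLeast-lo
    ; isMax    = isGreatest-hi
    ; nonempty = subst₂ ℤ._≤_ (sym (ceiling-n*k/n (size G) lo)) (sym (floor-n*k/n (size G) hi))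
                   (ℤ.+≤+ lo≤hi)
    }

  -- The upper bound is written `k < suc hi` to fit `ℕ.allUpTo?`.
  AllValences : Set
  AllValences = ∀ {k} → k < suc hi → lo ≤ k → IsValence G k

  allValences⇒perfect : AllValences → PerfectEdgeMagic G
  allValences⇒perfect all = hasInterval , (λ {k} k∈ → k∈ , valence k k∈) , proj₁
    where
    valence : ∀ k → edgeMagicInterval G hasInterval k → Σ[ f ∈ Labeling G ] IsEdgeMagic G f k
    valence k (lo≤k , k≤hi)
      -- Being at least `+ lo` forces the integer `k` to be nonnegative.
      with subst (ℤ._≤ k) (ceiling-n*k/n (size G) lo) lo≤k
         | subst (k ℤ.≤_) (floor-n*k/n (size G) hi) k≤hi
    ... | ℤ.+≤+ lo≤k′ | ℤ.+≤+ k≤hi′ = all (s≤s k≤hi′) lo≤k′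

  -- The given interval `I` is arbitrary, but least and greatest elements of `T` are unique, so its
  -- endpoints are `lo` and `hi`.
  perfect⇒allValences : PerfectEdgeMagic G → AllValences
  perfect⇒allValences (I , ⊆ , _) {k} (s≤s k≤hi) lo≤k = proj₂ (⊆
    ( subst (ℤ._≤ + k) (sym ceiling-minT) (ℤ.+≤+ lo≤k)
    , subst (+ k ℤ.≤_) (sym floor-maxT) (ℤ.+≤+ k≤hi) ))
    where
    open HasInterval I
    ceiling-minT : ceiling minT ≡ + lo
    ceiling-minT = trans
      (cong ceiling (ℚ.≤-antisym (proj₂ isMin (proj₁ isLeast-lo)) (proj₂ isLeast-lo (proj₁ isMin))))
      (ceiling-n*k/n (size G) lo)
    floor-maxT : floor maxT ≡ + hi
    floor-maxT = trans
      (cong floor (ℚ.≤-antisym (proj₂ isGreatest-hi (proj₁ isMax)) (proj₂ isMax (proj₁ isGreatest-hi))))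
      (floor-n*k/n (size G) hi)

  perfect? : Dec (PerfectEdgeMagic G)
  perfect? = map′ allValences⇒perfect perfect⇒allValences
    (ℕ.allUpTo? (λ k → (lo ℕ.≤? k) →-dec isValence? G k) (suc hi))

-- Stars with isolated vertices

-- An injective labeling of `G` alone, with labels from the larger range, suffices: the isolated
-- vertices lie on no edge and take whatever labels remain.
∃-labeling-∪K₁ : ∀ G m (f : V G ⊎ E G → Fin (labelCount (G ∪ m K₁))) → Inj f →
  Σ[ g ∈ Labeling (G ∪ m K₁) ]
    (∀ v → Bijection.to g (inj₁ (v ↑ˡ m)) ≡ f (inj₁ v)) × (∀ e → Bijection.to g (inj₂ e) ≡ f (inj₂ e))
∃-labeling-∪K₁ G m f inj
  with t , inj′ ← ∃-extension m (f ∘ splitAt (order G)) (splitAt-injective (order G) ∘ inj)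
                    (ℕ.≤-reflexive (xy∙z≈xz∙y (order G) (size G) m))
  = labeling (G ∪ m K₁) ([ f ∘ splitAt (order G) , t ]′ ∘ exchange (order G) m (size G))
      (λ {x} {y} eq → exchange-injective {x} {y} (inj′ eq))
  , (λ v → trans (cong ([ f ∘ splitAt (order G) , t ]′ ∘ [ inj₁ ∘ (_↑ˡ size G) , inj₂ ]′)
                       (Fin.splitAt-↑ˡ (order G) v m))
                 (cong f (Fin.splitAt-↑ˡ (order G) v (size G))))
  , (λ e → cong f (Fin.splitAt-↑ʳ (order G) (size G) e))
  where
  exchange-injective : Inj (exchange (order G) m (size G))
  exchange-injective = retraction⇒injective (exchange (order G) (size G) m)
                         (exchange-involutive (order G) m (size G))

module _ (n m : ℕ) where

  private
    G : Graph
    G = star n ∪ m K₁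

    lo hi : ℕ
    lo = 2 * n + 4
    hi = 4 * n + 2 + 3 * m

  lo+hi : lo + hi ≡ 3 * suc (labelCount G)
  lo+hi = identity n m
    where
    identity : ∀ n m → (2 * n + 4) + (4 * n + 2 + 3 * m) ≡ 3 * suc (suc n + m + n)
    identity = solve-∀

  -- Label the centre by 1, the leaves by 1 + [a , a + n) in order and the edges
  -- by 1 + [b , b + n) in reverse order.
  blocks-valence : ∀ a b → 1 ≤ a → a + n ≤ b → b + n ≤ labelCount G → IsValence G (a + b + n + 2)
  blocks-valence a b 1≤a a+n≤b b+n≤N = g , λ e → cong +_ (begin
    edgeSum G (label G g) e
      ≡⟨ cong₂ _+_ (cong₂ _+_ (cong suc (to-core {inj₁ zero} (onV zero)))
                              (cong suc (to-core {inj₁ (suc e)} (onV (suc e)))))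
                   (cong suc (to-core {inj₂ e} (onE e))) ⟩
    1 + suc (a + toℕ e) + suc (b + toℕ (opposite e))
      ≡⟨ regroup a b (toℕ e) (toℕ (opposite e)) ⟩
    a + b + (suc (toℕ e) + toℕ (opposite e)) + 2
      -- Because the blocks run in opposite orders, the two offsets add up to n - 1 for every `e`.
      ≡⟨ cong (λ s → a + b + (suc (toℕ e) + s) + 2) (Fin.opposite-prop e) ⟩
    a + b + (suc (toℕ e) + (n ∸ suc (toℕ e))) + 2
      ≡⟨ cong (λ s → a + b + s + 2) (ℕ.m+[n∸m]≡n (Fin.toℕ<n e)) ⟩
    a + b + n + 2 ∎)
    where
    open ≡.≡-Reasoning

    regroup : ∀ a b i j → 1 + suc (a + i) + suc (b + j) ≡ a + b + (suc i + j) + 2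
    regroup = solve-∀

    -- Values are labels minus one. `1 ≤ a` keeps the leaves off the centre's 0, and `a + n ≤ b`
    -- separates vertices from edges.
    core : V (star n) ⊎ E (star n) → ℕ
    core (inj₁ zero)    = 0
    core (inj₁ (suc i)) = a + toℕ i
    core (inj₂ e)       = b + toℕ (opposite e)

    core-vertex<b : ∀ v → core (inj₁ v) < b
    core-vertex<b zero    = ℕ.≤-trans 1≤a (ℕ.m+n≤o⇒m≤o a a+n≤b)
    core-vertex<b (suc i) = ℕ.<-≤-trans (ℕ.+-monoʳ-< a (Fin.toℕ<n i)) a+n≤b

    core<N : ∀ x → core x < labelCount G
    core<N (inj₁ v) = ℕ.<-≤-trans (core-vertex<b v) (ℕ.m+n≤o⇒m≤o b b+n≤N)
    core<N (inj₂ e) = ℕ.<-≤-trans (ℕ.+-monoʳ-< b (Fin.toℕ<n (opposite e))) b+n≤N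

    vertex≢edge : ∀ v e → core (inj₁ v) ≢ core (inj₂ e)
    vertex≢edge v e eq = ℕ.<⇒≱ (core-vertex<b v) (ℕ.≤-trans (ℕ.m≤m+n b _) (ℕ.≤-reflexive (sym eq)))

    centre≢leaf : ∀ i → 0 ≢ a + toℕ i
    centre≢leaf i = ℕ.<⇒≢ (ℕ.≤-trans 1≤a (ℕ.m≤m+n a _))

    core-injective : ∀ x y → core x ≡ core y → x ≡ y
    core-injective (inj₁ zero)    (inj₁ zero)    eq = refl
    core-injective (inj₁ zero)    (inj₁ (suc j)) eq = contradiction eq (centre≢leaf j)
    core-injective (inj₁ (suc i)) (inj₁ zero)    eq = contradiction (sym eq) (centre≢leaf i)
    core-injective (inj₁ (suc i)) (inj₁ (suc j)) eq =
      cong (inj₁ ∘ suc) (Fin.toℕ-injective (ℕ.+-cancelˡ-≡ a _ _ eq))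
    core-injective (inj₁ v)       (inj₂ e)       eq = contradiction eq (vertex≢edge v e)
    core-injective (inj₂ e)       (inj₁ v)       eq = contradiction (sym eq) (vertex≢edge v e)
    core-injective (inj₂ d)       (inj₂ e)       eq =
      cong inj₂ (opposite-injective (Fin.toℕ-injective (ℕ.+-cancelˡ-≡ b _ _ eq)))

    extension = ∃-labeling-∪K₁ (star n) m (λ x → fromℕ< (core<N x))
      (λ {x} {y} eq → core-injective x y (Fin.fromℕ<-injective _ _ (core<N x) (core<N y) eq))
    g   = proj₁ extension
    onV = proj₁ (proj₂ extension)
    onE = proj₂ (proj₂ extension)

    to-core : ∀ {x i} → i ≡ fromℕ< (core<N x) → toℕ i ≡ core x
    to-core {x} refl = Fin.toℕ-fromℕ< (core<N x)

  lo-isValence : IsValence G lo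
  lo-isValence = subst (IsValence G) (value n)
    -- The star receives the smallest labels: 1 at the centre, then 2 to n + 1 on the leaves and n +
    -- 2 to 2n + 1 on the edges.
    (blocks-valence 1 (suc n) ℕ.≤-refl ℕ.≤-refl (ℕ.+-monoˡ-≤ n (ℕ.m≤m+n (suc n) m)))
    where
    value : ∀ n → 1 + suc n + n + 2 ≡ 2 * n + 4
    value = solve-∀

  module _ .{{_ : NonZero n}} where

    -- The centre label occurs `n` times. One copy completes the 2n + 1 distinct labels of the star,
    -- whose sum is at least (2n + 1)(n + 1); the other n - 1 copies are at least 1 each.
    weightedSum-≥ : ∀ g → n * lo ≤ weightedSum G g
    weightedSum-≥ g = begin
      n * lo
        ≤⟨ arithmetic n centre rest (s≤s z≤n)
             (subst (λ s → (suc n + n) * suc (suc n + n) ≤ 2 * s) sum-labels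
               (sum-injective-≥ (suc n + n) {toℕ ∘ used}
                 (λ {x} {y} eq → used-injective {x} {y} (Fin.toℕ-injective eq)))) ⟩
      n * centre + rest
        ≡⟨ cong₂ _+_ (sum-const n centre) (∑-distrib-+ leaf (elabel G g)) ⟨
      ∑[ _ < n ] centre + ∑[ e < n ] (leaf e + elabel G g e)
        ≡⟨ ∑-distrib-+ {n} (λ _ → centre) _ ⟨
      ∑[ e < n ] (centre + (leaf e + elabel G g e))
        ≡⟨ sum-cong-≗ (λ e → ℕ.+-assoc centre (leaf e) (elabel G g e)) ⟨
      sum (edgeSum G (label G g))
        ≡⟨ weightedSum-edges G g ⟨
      weightedSum G g ∎
      where
      open ℕ.≤-Reasoning

      centre rest : ℕ
      leaf : Fin n → ℕ
      centre = vlabel G g zero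
      leaf i = vlabel G g (suc i ↑ˡ m)
      rest   = sum leaf + sum (elabel G g)

      starLabel : V (star n) ⊎ E (star n) → Fin (labelCount G)
      starLabel = [ Bijection.to g ∘ inj₁ ∘ (_↑ˡ m) , Bijection.to g ∘ inj₂ ]′

      used : Fin (suc n + n) → Fin (labelCount G)
      used = starLabel ∘ splitAt (suc n)

      used-injective : Inj used
      used-injective {x} {y} eq = splitAt-injective (suc n) (go (splitAt (suc n) x) (splitAt (suc n) y) eq)
        where
        go : ∀ x y → starLabel x ≡ starLabel y → x ≡ y
        go (inj₁ u) (inj₁ v) eq = cong inj₁ (Fin.↑ˡ-injective m _ _ (inj₁-injective (Bijection.injective g eq)))
        go (inj₁ u) (inj₂ e) eq = contradiction (Bijection.injective g eq) λ ()
        go (inj₂ e) (inj₁ v) eq = contradiction (Bijection.injective g eq) λ ()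
        go (inj₂ d) (inj₂ e) eq = cong inj₂ (inj₂-injective (Bijection.injective g eq))

      sum-labels : sum (suc ∘ toℕ ∘ used) ≡ centre + rest
      sum-labels = trans (sum-splitAt (suc n) (suc ∘ toℕ ∘ used)) (trans
        (cong₂ _+_
          (sum-cong-≗ {suc n} (λ v → cong (suc ∘ toℕ ∘ starLabel) (Fin.splitAt-↑ˡ (suc n) v n)))
          (sum-cong-≗ {n} (λ e → cong (suc ∘ toℕ ∘ starLabel) (Fin.splitAt-↑ʳ (suc n) n e))))
        (ℕ.+-assoc centre (sum leaf) _))

      arithmetic : ∀ n .{{_ : NonZero n}} c r → 1 ≤ c →
                   (suc n + n) * suc (suc n + n) ≤ 2 * (c + r) → n * (2 * n + 4) ≤ n * c + r
      -- Doubled to match `sum-injective-≥`; `p` counts the remaining copies of the centre label.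
      arithmetic (suc p) c r 1≤c bound = ℕ.*-cancelˡ-≤ 2 (begin
        2 * (suc p * (2 * suc p + 4))   ≡⟨ before p ⟩
        2 * (p * 1) + (suc (suc p) + suc p) * suc (suc (suc p) + suc p)
                                        ≤⟨ ℕ.+-mono-≤ (ℕ.*-monoʳ-≤ 2 (ℕ.*-monoʳ-≤ p 1≤c)) bound ⟩
        2 * (p * c) + 2 * (c + r)       ≡⟨ after p c r ⟩
        2 * (suc p * c + r)             ∎)
        where
        before : ∀ p → 2 * (suc p * (2 * suc p + 4))
                     ≡ 2 * (p * 1) + (suc (suc p) + suc p) * suc (suc (suc p) + suc p)
        before = solve-∀
        after : ∀ p c r → 2 * (p * c) + 2 * (c + r) ≡ 2 * (suc p * c + r)
        after = solve-∀

    extremes : Extremes G lo hi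
    extremes = record
      { lo≤hi      = ℕ.≤-trans (lo≤ n) (ℕ.m≤m+n _ _)
      ; lo-valence = lo-isValence
      ; hi-valence = isValence-complement G lo+hi lo-isValence
      ; lo-bound   = weightedSum-≥
      -- The lower bound applies to the complement, and the two weighted sums add up to
      -- `n * (lo + hi)`.
      ; hi-bound   = λ g → ℕ.+-cancelʳ-≤ (n * lo) _ _ (begin
          weightedSum G g + n * lo
            ≤⟨ ℕ.+-monoʳ-≤ (weightedSum G g) (weightedSum-≥ (complement G g)) ⟩
          weightedSum G g + weightedSum G (complement G g)
            ≡⟨ weightedSum-complement G g ⟩
          n * (3 * suc (labelCount G))
            ≡⟨ cong (n *_) lo+hi ⟨
          n * (lo + hi)
            ≡⟨ ℕ.*-distribˡ-+ n lo hi ⟩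
          n * lo + n * hi
            ≡⟨ ℕ.+-comm (n * lo) (n * hi) ⟩
          n * hi + n * lo ∎)
      }
      where
      open ℕ.≤-Reasoning
      -- This is where a star without edges would fail.
      lo≤ : ∀ n → .{{NonZero n}} → 2 * n + 4 ≤ 4 * n + 2
      lo≤ (suc p) = ℕ.≤-trans (ℕ.m≤m+n _ (2 * p)) (ℕ.≤-reflexive (identity p))
        where
        identity : ∀ p → 2 * suc p + 4 + 2 * p ≡ 4 * suc p + 2
        identity = solve-∀

-- For d ≤ 2n the block of edge labels moves up to the top; beyond that, it stays
-- there and the block of leaf labels moves up.
lower-valences : ∀ n d → d ≤ 4 * n → IsValence (star n ∪ (2 * n) K₁) (2 * n + 4 + d)
lower-valences n d d≤4n with ℕ.≤-total d (2 * n)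
... | inj₁ d≤2n = subst (IsValence (star n ∪ (2 * n) K₁)) (value n d)
  -- Here N = 4n + 1, so the edge block fits exactly when d ≤ 2n.
  (blocks-valence n (2 * n) 1 (suc n + d) ℕ.≤-refl (ℕ.m≤m+n (suc n) d)
    (ℕ.+-monoˡ-≤ n (ℕ.+-monoʳ-≤ (suc n) d≤2n)))
  where
  value : ∀ n d → 1 + (suc n + d) + n + 2 ≡ 2 * n + 4 + d
  value = solve-∀
... | inj₂ 2n≤d = subst (IsValence (star n ∪ (2 * n) K₁))
  (trans (value n (d ∸ 2 * n)) (cong (_+_ (2 * n + 4)) (ℕ.m+[n∸m]≡n 2n≤d)))
  -- The edges take the top `n` labels; the leaf block stays below them exactly when d ≤ 4n.
  (blocks-valence n (2 * n) (suc (d ∸ 2 * n)) (suc n + 2 * n) (s≤s z≤n)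
    (s≤s (ℕ.≤-trans (ℕ.+-monoˡ-≤ n d∸2n≤2n) (ℕ.≤-reflexive (ℕ.+-comm (2 * n) n))))
    ℕ.≤-refl)
  where
  value : ∀ n d → suc d + (suc n + 2 * n) + n + 2 ≡ 2 * n + 4 + (2 * n + d)
  value = solve-∀
  double : ∀ n → 4 * n ≡ 2 * n + 2 * n
  double = solve-∀
  d∸2n≤2n : d ∸ 2 * n ≤ 2 * n
  d∸2n≤2n = ℕ.m≤n+o⇒m∸n≤o d (2 * n) (ℕ.≤-trans d≤4n (ℕ.≤-reflexive (double n)))

-- For m = 2n the interval has hi - lo = 8n - 2, so the 4n + 1 valences from `lo` upwards and their
-- mirror images below `hi` overlap and cover it.
allValences-star∪2nK₁ : ∀ n .{{_ : NonZero n}} → AllValences (extremes n (2 * n))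
allValences-star∪2nK₁ n {k} (s≤s k≤hi) lo≤k with ℕ.≤-total k (2 * n + 4 + 4 * n)
... | inj₁ k≤mid = subst (IsValence (star n ∪ (2 * n) K₁)) (ℕ.m+[n∸m]≡n lo≤k)
  (lower-valences n (k ∸ (2 * n + 4)) (ℕ.m≤n+o⇒m∸n≤o k (2 * n + 4) k≤mid))
... | inj₂ mid≤k = isValence-complement (star n ∪ (2 * n) K₁) reflected
  -- The mirror image of `k` is lo + (hi - k), and hi + 2 = lo + 8n bounds the offset by 4n.
  (lower-valences n (hi ∸ k) (ℕ.m≤n+o⇒m∸n≤o hi k (begin
    hi                         ≤⟨ ℕ.m≤m+n hi 2 ⟩
    hi + 2                     ≡⟨ midpoint n ⟩
    2 * n + 4 + 4 * n + 4 * n  ≤⟨ ℕ.+-monoˡ-≤ (4 * n) mid≤k ⟩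
    k + 4 * n                  ∎)))
  where
  open ℕ.≤-Reasoning
  hi = 4 * n + 2 + 3 * (2 * n)
  midpoint : ∀ n → 4 * n + 2 + 3 * (2 * n) + 2 ≡ 2 * n + 4 + 4 * n + 4 * n
  midpoint = solve-∀
  reflected : 2 * n + 4 + (hi ∸ k) + k ≡ 3 * suc (labelCount (star n ∪ (2 * n) K₁))
  reflected = trans (ℕ.+-assoc (2 * n + 4) (hi ∸ k) k)
    (trans (cong (_+_ (2 * n + 4)) (ℕ.m∸n+n≡m k≤hi)) (lo+hi n (2 * n)))

theorem3p4 : ∀ (n : ℕ) .{{_ : NonZero n}} → ∃[ μ ] (IsDeficiency (star n) μ × μ <⁺ ⊤⁺)
theorem3p4 n
  -- `2 * n` only bounds the search; the least value found may be smaller.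
  with μ , isLeast ← least (λ m → perfect? (extremes n m)) (2 * n)
                       (allValences⇒perfect (extremes n (2 * n)) (allValences-star∪2nK₁ n))
  = [ μ ] , isLeast , [ μ ]<⊤⁺
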